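{- Consider the problem of maximizing a linear function $g(\mathbf{z})$ over $\mathbf{z}=(\mathbf{x},\mathbf{y})\in\mathbb{R}^{m+n}$ subject to $\mathcal{B}(\mathbf{x},\mathbf{y})\preceq 0$, where $\mathcal{B}(\mathbf{x},\mathbf{y})=F+\sum_i x_iH_i+\sum_j y_jG_j+\sum_{i,j}x_iy_jF_{i,j}$. Run the iterative procedure described below starting from a strictly feasible $\mathbf{z}^0$ (i.e., $\mathcal{B}(\mathbf{z}^0)\prec 0$). Then every iterate $\mathbf{z}^i$ produced by the procedure (for every $i$ for which it is produced) is a feasible solution of this problem, i.e., $\mathcal{B}(\mathbf{z}^i)\preceq 0$.
   Context: $F,H_i,G_j,F_{i,j}$ are constant real symmetric $p\times p$ matrices; $\preceq$ is the positive-semidefinite (Loewner) order. Decompose $\mathcal{B}=\mathcal{B}^+-\mathcal{B}^-$ as follows: $\Gamma$ is the $mp\times np$ block matrix with $(i,j)$ block $\tfrac12F_{i,j}$, $\Omega=(H_1\cdots H_m\ G_1\cdots G_n)$, $M=\begin{pmatrix}0&\Gamma\\ \Gamma^{\mathsf T}&0\end{pmatrix}=V^{\mathsf T}DV$ an eigendecomposition, $D^+$ is $D$ with negative entries set to $0$, $D^-=D^+-D$, $M_1=V^{\mathsf T}D^+V$, $M_2=V^{\mathsf T}D^-V$, $\mathcal{B}^+(\mathbf{z})=(\mathbf{z}\otimes I)^{\mathsf T}M_1(\mathbf{z}\otimes I)+\Omega(\mathbf{z}\otimes I)+F$, $\mathcal{B}^-(\mathbf{z})=(\mathbf{z}\otimes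 I)^{\mathsf T}M_2(\mathbf{z}\otimes I)$ ($I$ the $p\times p$ identity). $\mathcal{D}\mathcal{B}^-(\mathbf{z})(\mathbf{u})=\sum_i u_i\,\partial\mathcal{B}^-/\partial z_i(\mathbf{z})$. The iterative procedure (Algorithm 1, BMI-DC): given $\mathbf{z}^k$, let $\mathbf{z}^{k+1}$ be an optimal solution of the convex problem: maximize $g(\mathbf{z})+\tfrac12\delta\|\mathbf{z}-\mathbf{z}^k\|^2$ (with a fixed $\delta<0$) subject to $\mathcal{B}^+(\mathbf{z})-\mathcal{B}^-(\mathbf{z}^k)-\mathcal{D}\mathcal{B}^-(\mathbf{z}^k)(\mathbf{z}-\mathbf{z}^k)\preceq 0$; repeat until $\|\mathbf{z}^k-\mathbf{z}^{k-1}\|<\varepsilon$ for a given tolerance $\varepsilon\ge 0$, and return the set of all iterates $\mathbf{z}^0,\dots,\mathbf{z}^k$. -}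

module Defs where

open import Level using (Level; suc) renaming (_⊔_ to _⊔ˡ_)
open import Algebra.Apartness.Bundles using (HeytingCommutativeRing; HeytingField)
open import Algebra.Bundles using (CommutativeRing)
import Algebra.Definitions.RawMonoid as RawMonoidDefinitions
import Algebra.Properties.Ring as RingProperties
open import Data.Empty using (⊥; ⊥-elim)
open import Data.Fin.Base using (Fin; splitAt; remQuot; combine)
open import Data.Fin.Properties using (_≟_)
import Data.Nat.Base as ℕ
open ℕ using (ℕ)
open import Data.Product.Base using (∃; _×_; _,_; proj₁; proj₂)
open import Data.Sum.Base as Sum using (_⊎_; inj₁; inj₂)
open import Data.Vec.Functional using (Vector; _++_; take; drop; updateAt)
open import Function.Bundles using (_⇔_; Equivalence)
open import Relation.Binary.Core using (Rel)
open import Relation.Binary.Lattice.Definitions using (Supremum)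
open import Relation.Binary.Structures using (IsStrictPartialOrder)
open import Relation.Nullary using (¬_; yes; no)

-- The real numbers, axiomatised as a Cauchy-complete Archimedean ordered
-- field.  Classically these axioms determine ℝ up to isomorphism; they are
-- phrased so that constructive models of ℝ satisfy them too (whence the
-- apartness relation, and _≤_ as the negation of the reversed strict order).
-- The operations _⊔_ (binary maximum) and √ add no generality: both exist in
-- every model of the remaining axioms, classically, and are determined by
-- their laws (√ on the nonnegative numbers).
record Reals (c ℓ₁ ℓ₂ ℓ₃ : Level) : Set (suc (c ⊔ˡ ℓ₁ ⊔ˡ ℓ₂ ⊔ˡ ℓ₃)) where
  infix  4 _<_ _≤_
  infixl 6 _⊔_
  field
    heytingField : HeytingField c ℓ₁ ℓ₂

  open HeytingField heytingField public

  commutativeRing : CommutativeRing c ℓ₁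
  commutativeRing = HeytingCommutativeRing.commutativeRing heytingCommutativeRing

  open RawMonoidDefinitions (CommutativeRing.+-rawMonoid commutativeRing) public
    using (sum) renaming (_×_ to _·ℕ_)

  field
    _<_                  : Rel Carrier ℓ₃
    isStrictPartialOrder : IsStrictPartialOrder _≈_ _<_
    #⇔<⊎>                : ∀ {x y} → x # y ⇔ (x < y ⊎ y < x)
    +-monoˡ-<            : ∀ {x y} z → x < y → x + z < y + z
    *-pos                : ∀ {x y} → 0# < x → 0# < y → 0# < x * y

  _≤_ : Rel Carrier ℓ₃
  x ≤ y = ¬ (y < x)

  field
    _⊔_      : Carrier → Carrier → Carrier
    supremum : Supremum _≤_ _⊔_

  ∣_∣ : Carrier → Carrier
  ∣ x ∣ = x ⊔ (- x)

  field
    √        : Carrier → Carrier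
    √-nonneg : ∀ {x} → 0# ≤ x → 0# ≤ √ x
    √-square : ∀ {x} → 0# ≤ x → √ x * √ x ≈ x

    archimedean : ∀ x → ∃ λ (k : ℕ) → x < k ·ℕ 1#

    complete : (s : ℕ → Carrier) →
      (∀ ε → 0# < ε → ∃ λ N → ∀ i j → N ℕ.≤ i → N ℕ.≤ j → ∣ s i - s j ∣ < ε) →
      ∃ λ l → ∀ ε → 0# < ε → ∃ λ N → ∀ i → N ℕ.≤ i → ∣ s i - l ∣ < ε

  private
    module SPO = IsStrictPartialOrder isStrictPartialOrder
    module R = CommutativeRing commutativeRing
    open RingProperties R.ring using (-0#≈0#; -‿distribˡ-*; -‿involutive)

  x-0≈x : ∀ x → x - 0# ≈ x
  x-0≈x x = trans (+-cong refl -0#≈0#) (+-identityʳ x)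

  1#0 : 1# # 0#
  1#0 = invertible⇒#
    (1# , trans (*-identityˡ _) (x-0≈x 1#) , trans (*-identityʳ _) (x-0≈x 1#))

  0<1 : 0# < 1#
  0<1 with Equivalence.to #⇔<⊎> 1#0
  ... | inj₂ 0<1 = 0<1
  ... | inj₁ 1<0 = ⊥-elim (SPO.irrefl refl (SPO.trans 1<0 0<1′))
    where
    0<-1 : 0# < - 1#
    0<-1 = SPO.<-respʳ-≈ (+-identityˡ _)
             (SPO.<-respˡ-≈ (-‿inverseʳ 1#) (+-monoˡ-< (- 1#) 1<0))
    -1*-1≈1 : - 1# * - 1# ≈ 1#
    -1*-1≈1 = trans (sym (-‿distribˡ-* 1# (- 1#)))
                (trans (-‿cong (*-identityˡ _)) (-‿involutive 1#))
    0<1′ : 0# < 1#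
    0<1′ = SPO.<-respʳ-≈ -1*-1≈1 (*-pos 0<-1 0<-1)

  2#0 : 1# + 1# # 0#
  2#0 = Equivalence.from #⇔<⊎> (inj₂ (SPO.trans 0<1
          (SPO.<-respˡ-≈ (+-identityˡ 1#) (+-monoˡ-< 1# 0<1))))

  ½ : Carrier
  ½ = proj₁ (#⇒invertible 2#0)

module LinearAlgebra {c ℓ₁ ℓ₂ ℓ₃} (ℝ : Reals c ℓ₁ ℓ₂ ℓ₃) where
  open Reals ℝ

  infixl 6 _-ⱽ_ _+ᴹ_ _-ᴹ_
  infixr 7 _·ᴹ_
  infixl 7 _*ᴹ_
  infix  8 _ᵀ
  infix  4 _≈ᴹ_ _⪯_ _≺_

  ℝ^_ : ℕ → Set c
  ℝ^ n = Vector Carrier n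

  _-ⱽ_ : ∀ {n} → ℝ^ n → ℝ^ n → ℝ^ n
  (u -ⱽ v) i = u i - v i

  ‖_‖ : ∀ {n} → ℝ^ n → Carrier
  ‖ v ‖ = √ (sum λ i → v i * v i)

  record IsLinear {n} (g : ℝ^ n → Carrier) : Set (c ⊔ˡ ℓ₁) where
    field
      cong   : ∀ {u v} → (∀ i → u i ≈ v i) → g u ≈ g v
      +-homo : ∀ u v → g (λ i → u i + v i) ≈ g u + g v
      *-homo : ∀ a v → g (λ i → a * v i) ≈ a * g v

  Matrix : ℕ → ℕ → Set c
  Matrix k l = Fin k → Fin l → Carrier

  _≈ᴹ_ : ∀ {k l} → Matrix k l → Matrix k l → Set ℓ₁
  A ≈ᴹ B = ∀ a b → A a b ≈ B a b

  0ᴹ : ∀ {k l} → Matrix k l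
  0ᴹ a b = 0#

  _+ᴹ_ _-ᴹ_ : ∀ {k l} → Matrix k l → Matrix k l → Matrix k l
  (A +ᴹ B) a b = A a b + B a b
  (A -ᴹ B) a b = A a b - B a b

  _·ᴹ_ : ∀ {k l} → Carrier → Matrix k l → Matrix k l
  (t ·ᴹ A) a b = t * A a b

  _*ᴹ_ : ∀ {k l q} → Matrix k l → Matrix l q → Matrix k q
  (A *ᴹ B) a b = sum λ e → A a e * B e b

  _ᵀ : ∀ {k l} → Matrix k l → Matrix l k
  (A ᵀ) a b = A b a

  ∑ᴹ : ∀ {N k l} → Vector (Matrix k l) N → Matrix k l
  ∑ᴹ A a b = sum λ i → A i a b

  diag : ∀ {k} → ℝ^ k → Matrix k k
  diag d a b with a ≟ b
  ... | yes _ = d a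
  ... | no  _ = 0#

  Iₘ : ∀ {k} → Matrix k k
  Iₘ = diag λ _ → 1#

  Symmetric : ∀ {k} → Matrix k k → Set ℓ₁
  Symmetric A = A ᵀ ≈ᴹ A

  quadraticForm : ∀ {k} → Matrix k k → ℝ^ k → Carrier
  quadraticForm A v = sum λ a → sum λ b → v a * A a b * v b

  PositiveSemidefinite : ∀ {k} → Matrix k k → Set (c ⊔ˡ ℓ₁ ⊔ˡ ℓ₃)
  PositiveSemidefinite A = Symmetric A × (∀ v → 0# ≤ quadraticForm A v)

  PositiveDefinite : ∀ {k} → Matrix k k → Set (c ⊔ˡ ℓ₁ ⊔ˡ ℓ₂ ⊔ˡ ℓ₃)
  PositiveDefinite A =
    Symmetric A × (∀ v → (∃ λ a → v a # 0#) → 0# < quadraticForm A v)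

  _⪯_ : ∀ {k} → Matrix k k → Matrix k k → Set (c ⊔ˡ ℓ₁ ⊔ˡ ℓ₃)
  A ⪯ B = PositiveSemidefinite (B -ᴹ A)

  _≺_ : ∀ {k} → Matrix k k → Matrix k k → Set (c ⊔ˡ ℓ₁ ⊔ˡ ℓ₂ ⊔ˡ ℓ₃)
  A ≺ B = PositiveDefinite (B -ᴹ A)

  -- A = Vᵀ D V with V orthogonal and D = diag eigenvalues.
  record Eigendecomposition {k} (A : Matrix k k) : Set (c ⊔ˡ ℓ₁) where
    field
      V           : Matrix k k
      eigenvalues : ℝ^ k
      VᵀV≈I       : V ᵀ *ᴹ V ≈ᴹ Iₘ
      VVᵀ≈I       : V *ᴹ V ᵀ ≈ᴹ Iₘ
      A≈VᵀDV      : A ≈ᴹ V ᵀ *ᴹ diag eigenvalues *ᴹ V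

    D : Matrix k k
    D = diag eigenvalues

  -- ∂f/∂zᵢ (z) = d, with the difference quotient multiplied out:
  -- f (z + t eᵢ) - f z - t d = o(t) as t → 0.
  HasPartialDerivative : ∀ {N} → (ℝ^ N → Carrier) → Fin N → ℝ^ N → Carrier →
                         Set (c ⊔ˡ ℓ₃)
  HasPartialDerivative f i z d =
    ∀ ε → 0# < ε → ∃ λ η → 0# < η × (∀ t → ∣ t ∣ < η →
      ∣ (f (updateAt z i (_+ t)) - f z) - t * d ∣ ≤ ε * ∣ t ∣)

  -- z ⊗ I, for z a column vector and I the p × p identity.  Row indices of
  -- block matrices are flattened: block i, offset a is `combine i a`.
  _⊗I : ∀ {N p} → ℝ^ N → Matrix (N ℕ.* p) p
  _⊗I {p = p} z r b = let (i , a) = remQuot p r in z i * Iₘ a b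

  fromBlocks : ∀ {k k′ l l′} →
    Matrix k l  → Matrix k l′ →
    Matrix k′ l → Matrix k′ l′ →
    Fin k ⊎ Fin k′ → Fin l ⊎ Fin l′ → Carrier
  fromBlocks A B C D (inj₁ r) (inj₁ s) = A r s
  fromBlocks A B C D (inj₁ r) (inj₂ s) = B r s
  fromBlocks A B C D (inj₂ r) (inj₁ s) = C r s
  fromBlocks A B C D (inj₂ r) (inj₂ s) = D r s

module BMI {c ℓ₁ ℓ₂ ℓ₃} (ℝ : Reals c ℓ₁ ℓ₂ ℓ₃) where
  open Reals ℝ
  open LinearAlgebra ℝ

  -- Maximise g (x , y) subject to 𝓑 x y ⪯ 0; a point z = (x , y) is x ++ y.
  record Problem (m n p : ℕ) : Set (c ⊔ˡ ℓ₁) where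
    field
      F             : Matrix p p
      H             : Vector (Matrix p p) m
      G             : Vector (Matrix p p) n
      Fᵢⱼ           : Fin m → Fin n → Matrix p p
      F-symmetric   : Symmetric F
      H-symmetric   : ∀ i → Symmetric (H i)
      G-symmetric   : ∀ j → Symmetric (G j)
      Fᵢⱼ-symmetric : ∀ i j → Symmetric (Fᵢⱼ i j)
      g             : ℝ^ (m ℕ.+ n) → Carrier
      g-linear      : IsLinear g

    𝓑 : ℝ^ m → ℝ^ n → Matrix p p
    𝓑 x y = F +ᴹ ∑ᴹ (λ i → x i ·ᴹ H i) +ᴹ ∑ᴹ (λ j → y j ·ᴹ G j)
              +ᴹ ∑ᴹ (λ i → ∑ᴹ λ j → (x i * y j) ·ᴹ Fᵢⱼ i j)

    𝓑[_] : ℝ^ (m ℕ.+ n) → Matrix p p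
    𝓑[ z ] = 𝓑 (take m z) (drop m z)

    Feasible : ℝ^ (m ℕ.+ n) → Set (c ⊔ˡ ℓ₁ ⊔ˡ ℓ₃)
    Feasible z = 𝓑[ z ] ⪯ 0ᴹ

    StrictlyFeasible : ℝ^ (m ℕ.+ n) → Set (c ⊔ˡ ℓ₁ ⊔ˡ ℓ₂ ⊔ˡ ℓ₃)
    StrictlyFeasible z = 𝓑[ z ] ≺ 0ᴹ

    Γ : Matrix (m ℕ.* p) (n ℕ.* p)
    Γ r s = let (i , a) = remQuot p r ; (j , b) = remQuot p s in ½ * Fᵢⱼ i j a b

    Ω : Matrix p ((m ℕ.+ n) ℕ.* p)
    Ω a s = let (i , b) = remQuot p s in (H ++ G) i a b

    -- The identification of (m + n) p with m p + n p under which z ⊗ I is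
    -- x ⊗ I stacked on y ⊗ I.
    split : Fin ((m ℕ.+ n) ℕ.* p) → Fin (m ℕ.* p) ⊎ Fin (n ℕ.* p)
    split r = let (i , a) = remQuot p r in
      Sum.map (λ i₁ → combine i₁ a) (λ i₂ → combine i₂ a) (splitAt m i)

    M : Matrix ((m ℕ.+ n) ℕ.* p) ((m ℕ.+ n) ℕ.* p)
    M r s = fromBlocks 0ᴹ    Γ
                       (Γ ᵀ) 0ᴹ (split r) (split s)

  module Decomposition {m n p} (P : Problem m n p)
                       (E : Eigendecomposition (Problem.M P)) where
    open Problem P
    open Eigendecomposition E

    D⁺ D⁻ M₁ M₂ : Matrix ((m ℕ.+ n) ℕ.* p) ((m ℕ.+ n) ℕ.* p)
    D⁺ = diag λ r → eigenvalues r ⊔ 0#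
    D⁻ = D⁺ -ᴹ D
    M₁ = V ᵀ *ᴹ D⁺ *ᴹ V
    M₂ = V ᵀ *ᴹ D⁻ *ᴹ V

    𝓑⁺ 𝓑⁻ : ℝ^ (m ℕ.+ n) → Matrix p p
    𝓑⁺ z = (z ⊗I) ᵀ *ᴹ M₁ *ᴹ (z ⊗I) +ᴹ Ω *ᴹ (z ⊗I) +ᴹ F
    𝓑⁻ z = (z ⊗I) ᵀ *ᴹ M₂ *ᴹ (z ⊗I)

    -- `∂𝓑⁻ i z` is the entrywise partial derivative of 𝓑⁻ along zᵢ at z.
    IsPartialsOf𝓑⁻ : (Fin (m ℕ.+ n) → ℝ^ (m ℕ.+ n) → Matrix p p) → Set (c ⊔ˡ ℓ₃)
    IsPartialsOf𝓑⁻ ∂𝓑⁻ = ∀ i z a b →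
      HasPartialDerivative (λ w → 𝓑⁻ w a b) i z (∂𝓑⁻ i z a b)

    module Algorithm (∂𝓑⁻ : Fin (m ℕ.+ n) → ℝ^ (m ℕ.+ n) → Matrix p p)
                     (δ ε : Carrier) where

      𝓓𝓑⁻ : ℝ^ (m ℕ.+ n) → ℝ^ (m ℕ.+ n) → Matrix p p
      𝓓𝓑⁻ z u = ∑ᴹ λ i → u i ·ᴹ ∂𝓑⁻ i z

      objective : ℝ^ (m ℕ.+ n) → ℝ^ (m ℕ.+ n) → Carrier
      objective zᵏ z = g z + ½ * δ * (‖ z -ⱽ zᵏ ‖ * ‖ z -ⱽ zᵏ ‖)

      SubproblemFeasible : ℝ^ (m ℕ.+ n) → ℝ^ (m ℕ.+ n) → Set (c ⊔ˡ ℓ₁ ⊔ˡ ℓ₃)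
      SubproblemFeasible zᵏ z = 𝓑⁺ z -ᴹ 𝓑⁻ zᵏ -ᴹ 𝓓𝓑⁻ zᵏ (z -ⱽ zᵏ) ⪯ 0ᴹ

      SubproblemOptimal : ℝ^ (m ℕ.+ n) → ℝ^ (m ℕ.+ n) → Set (c ⊔ˡ ℓ₁ ⊔ˡ ℓ₃)
      SubproblemOptimal zᵏ z = SubproblemFeasible zᵏ z ×
        (∀ w → SubproblemFeasible zᵏ w → objective zᵏ w ≤ objective zᵏ z)

      -- The stopping test, first performed once z¹ is available.
      StopsAt : (ℕ → ℝ^ (m ℕ.+ n)) → ℕ → Set ℓ₃
      StopsAt z (ℕ.suc k) = ‖ z (ℕ.suc k) -ⱽ z k ‖ < ε
      StopsAt z ℕ.zero    = Level.Lift _ ⊥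

      -- `Produced z k`: z 0, …, z k are the successive iterates of a run that
      -- reaches step k.  Values of z past the end of the run are irrelevant.
      data Produced (z : ℕ → ℝ^ (m ℕ.+ n)) : ℕ → Set (c ⊔ˡ ℓ₁ ⊔ˡ ℓ₃) where
        start : Produced z 0
        next  : ∀ {k} → Produced z k → ¬ StopsAt z k →
                SubproblemOptimal (z k) (z (ℕ.suc k)) → Produced z (ℕ.suc k)

{-# OPTIONS --safe #-}
-- Since M₁ - M₂ = M, we have 𝓑⁺ = 𝓑 + 𝓑⁻.  Each entry of 𝓑⁻ is a quadratic
-- form in z, so its Taylor expansion is exact:
--   𝓑⁻ w = 𝓑⁻ z + 𝓓𝓑⁻ z (w - z) + 𝓑⁻ (w - z),
-- and 𝓑⁻ (w - z) ⪰ 0 because it is congruent to the nonnegative diagonal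
-- matrix D⁻.  Hence the constraint of the convex subproblem at z exceeds 𝓑 w
-- by 𝓑⁻ (w - z) ⪰ 0, and every solution w of the subproblem is feasible,
-- whatever z is.
module Submission where

open import Algebra.Bundles using (CommutativeRing)
import Algebra.Properties.Ring as RingProperties
import Algebra.Properties.Semiring.Sum as SemiringSum
import Algebra.Solver.Ring.NaturalCoefficients.Default as SemiringSolver
open import Data.Fin.Base using (Fin; zero; suc; _↑ˡ_; _↑ʳ_; combine; splitAt)
open import Data.Fin.Properties using (_≟_; remQuot-combine; splitAt-↑ˡ; splitAt-↑ʳ)
open import Data.Nat.Base using (ℕ) renaming (_+_ to _+ℕ_; _*_ to _*ℕ_)
open import Data.Product.Base using (_×_; _,_; proj₁; proj₂)
open import Data.Sum.Base as Sum using (_⊎_; inj₁; inj₂; [_,_]′)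
open import Data.Vec.Functional using (take; drop; updateAt; _++_)
open import Data.Vec.Functional.Properties
  using (updateAt-updates; updateAt-minimal; lookup-++ˡ; lookup-++ʳ)
open import Function.Bundles using (Equivalence)
open import Relation.Binary.PropositionalEquality.Core as ≡ using (_≡_; _≢_)
import Relation.Binary.Reasoning.Setoid as SetoidReasoning
open import Relation.Binary.Structures using (IsStrictPartialOrder)
open import Relation.Nullary using (¬_; yes; no; contradiction)
open import Defs

-- Order, absolute value and halving in the reals.

module RealsProperties {c ℓ₁ ℓ₂ ℓ₃} (ℝ : Reals c ℓ₁ ℓ₂ ℓ₃) where
  open Reals ℝ
  open CommutativeRing commutativeRing using (ring; commutativeSemiring)
  open IsStrictPartialOrder isStrictPartialOrder
    using (<-respʳ-≈; <-respˡ-≈)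
    renaming (irrefl to <-irrefl; trans to <-trans; asym to <-asym)
  open RingProperties ring
  open SemiringSolver commutativeSemiring
    using (solve; _:+_; _:*_; _:=_)

  -- Inherited from cotransitivity of apartness; it stands in for trichotomy, which the order is not
  -- assumed to have.
  <-cotrans : ∀ {x y} → x < y → ∀ z → x < z ⊎ z < y
  <-cotrans x<y z with #-cotrans (Equivalence.from #⇔<⊎> (inj₁ x<y)) z
  ... | inj₁ x#z with Equivalence.to #⇔<⊎> x#z
  ...   | inj₁ x<z = inj₁ x<z
  ...   | inj₂ z<x = inj₂ (<-trans z<x x<y)
  <-cotrans x<y z | inj₂ z#y with Equivalence.to #⇔<⊎> z#y
  ...   | inj₁ z<y = inj₂ z<y
  ...   | inj₂ y<z = inj₁ (<-trans x<y y<z)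

  ≤-trans : ∀ {x y z} → x ≤ y → y ≤ z → x ≤ z
  ≤-trans {y = y} x≤y y≤z z<x with <-cotrans z<x y
  ... | inj₁ z<y = y≤z z<y
  ... | inj₂ y<x = x≤y y<x

  ≤-reflexive : ∀ {x y} → x ≈ y → x ≤ y
  ≤-reflexive x≈y y<x = <-irrefl (sym x≈y) y<x

  ≤-resp-≈ : ∀ {w x y z} → w ≈ x → y ≈ z → w ≤ y → x ≤ z
  ≤-resp-≈ w≈x y≈z w≤y z<x = w≤y (<-respˡ-≈ (sym y≈z) (<-respʳ-≈ (sym w≈x) z<x))

  <⇒≤ : ∀ {x y} → x < y → x ≤ y
  <⇒≤ x<y y<x = <-asym x<y y<x

  ≤-antisym : ∀ {x y} → x ≤ y → y ≤ x → x ≈ y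
  ≤-antisym x≤y y≤x = proj₁ (tight _ _) λ x#y → [ y≤x , x≤y ]′ (Equivalence.to #⇔<⊎> x#y)

  +-monoˡ-≤ : ∀ {x y} z → x ≤ y → x + z ≤ y + z
  +-monoˡ-≤ z x≤y y+z<x+z =
    x≤y (<-respˡ-≈ (//-rightDividesʳ z _) (<-respʳ-≈ (//-rightDividesʳ z _) (+-monoˡ-< (- z) y+z<x+z)))

  +-mono-≤ : ∀ {w x y z} → w ≤ x → y ≤ z → w + y ≤ x + z
  +-mono-≤ {x = x} {y} w≤x y≤z = ≤-trans (+-monoˡ-≤ y w≤x)
    (≤-resp-≈ (+-comm y x) (+-comm _ x) (+-monoˡ-≤ x y≤z))

  +-nonneg : ∀ {x y} → 0# ≤ x → 0# ≤ y → 0# ≤ x + y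
  +-nonneg 0≤x 0≤y = ≤-resp-≈ (+-identityˡ 0#) refl (+-mono-≤ 0≤x 0≤y)

  x<y⇒0<y-x : ∀ {x y} → x < y → 0# < y - x
  x<y⇒0<y-x {x} x<y = <-respˡ-≈ (-‿inverseʳ x) (+-monoˡ-< (- x) x<y)

  0<y-x⇒x<y : ∀ {x y} → 0# < y - x → x < y
  0<y-x⇒x<y {x} {y} p = <-respˡ-≈ (+-identityˡ x) (<-respʳ-≈ (//-rightDividesˡ x y) (+-monoˡ-< x p))

  x≤y⇒0≤y-x : ∀ {x y} → x ≤ y → 0# ≤ y - x
  x≤y⇒0≤y-x {x} x≤y = ≤-resp-≈ (-‿inverseʳ x) refl (+-monoˡ-≤ (- x) x≤y)

  x<0⇒0<-x : ∀ {x} → x < 0# → 0# < - x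
  x<0⇒0<-x x<0 = <-respʳ-≈ (+-identityˡ _) (x<y⇒0<y-x x<0)

  *-monoˡ-< : ∀ {x y z} → 0# < z → x < y → z * x < z * y
  *-monoˡ-< {x} {y} {z} 0<z x<y =
    0<y-x⇒x<y (<-respʳ-≈ (x[y-z]≈xy-xz z y x) (*-pos 0<z (x<y⇒0<y-x x<y)))

  *-cancelˡ-≤ : ∀ {x y z} → 0# < z → z * x ≤ z * y → x ≤ y
  *-cancelˡ-≤ 0<z zx≤zy y<x = zx≤zy (*-monoˡ-< 0<z y<x)

  -- The case split is available only under a double negation, which is enough when the goal is
  -- itself a negation, as every `_≤_` is.
  nonneg-cases : ∀ {x} → 0# ≤ x → ¬ ¬ (0# < x ⊎ x ≈ 0#)
  nonneg-cases 0≤x k =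
    k (inj₂ (≤-antisym (λ 0<x → k (inj₁ 0<x)) 0≤x))

  *-nonneg : ∀ {x y} → 0# ≤ x → 0# ≤ y → 0# ≤ x * y
  *-nonneg {x} {y} 0≤x 0≤y xy<0 = nonneg-cases 0≤x λ
    { (inj₂ x≈0) → <-irrefl (trans (*-congʳ x≈0) (zeroˡ y)) xy<0
    ; (inj₁ 0<x) → nonneg-cases 0≤y λ
      { (inj₂ y≈0) → <-irrefl (trans (*-congˡ y≈0) (zeroʳ x)) xy<0
      ; (inj₁ 0<y) → <-asym xy<0 (*-pos 0<x 0<y) } }

  -x*-x≈x*x : ∀ x → - x * - x ≈ x * x
  -x*-x≈x*x x = trans (sym (-‿distribˡ-* x (- x)))
    (trans (-‿cong (sym (-‿distribʳ-* x x))) (-‿involutive _))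

  square-nonneg : ∀ x → 0# ≤ x * x
  -- Under the assumption `xx<0`, a negative `x` would make `- x * - x` positive, so `x` is
  -- nonnegative and the product of nonnegatives refutes the assumption.
  square-nonneg x xx<0 = *-nonneg 0≤x 0≤x xx<0
    where
    0≤x : 0# ≤ x
    0≤x x<0 = <-asym xx<0
      (<-respʳ-≈ (-x*-x≈x*x x) (*-pos (x<0⇒0<-x x<0) (x<0⇒0<-x x<0)))

  ∣x∣≤y⇒x≤y : ∀ {x y} → ∣ x ∣ ≤ y → x ≤ y
  ∣x∣≤y⇒x≤y {x} = ≤-trans (proj₁ (supremum x (- x)))

  ∣x∣≤y⇒-x≤y : ∀ {x y} → ∣ x ∣ ≤ y → - x ≤ y
  ∣x∣≤y⇒-x≤y {x} = ≤-trans (proj₁ (proj₂ (supremum x (- x))))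

  0<x⇒-x≤x : ∀ {x} → 0# < x → - x ≤ x
  0<x⇒-x≤x {x} 0<x = ≤-trans
    (<⇒≤ (<-respʳ-≈ (-‿inverseʳ x) (<-respˡ-≈ (+-identityˡ (- x)) (+-monoˡ-< (- x) 0<x))))
    (<⇒≤ 0<x)

  0<x⇒∣x∣≈x : ∀ {x} → 0# < x → ∣ x ∣ ≈ x
  0<x⇒∣x∣≈x {x} 0<x = ≤-antisym
    (proj₂ (proj₂ (supremum x (- x))) x (≤-reflexive refl) (0<x⇒-x≤x 0<x))
    (proj₁ (supremum x (- x)))

  0<x⇒∣-x∣≈x : ∀ {x} → 0# < x → ∣ - x ∣ ≈ x
  0<x⇒∣-x∣≈x {x} 0<x = ≤-antisym
    (proj₂ (proj₂ (supremum (- x) (- - x))) x (0<x⇒-x≤x 0<x) (≤-reflexive (-‿involutive x)))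
    (≤-trans (≤-reflexive (sym (-‿involutive x))) (proj₁ (proj₂ (supremum (- x) (- - x)))))

  -- `_⊔_` is specified only as a supremum, so its compatibility with `_≈_` is recovered from the
  -- order by antisymmetry.
  ∣∣-cong : ∀ {x y} → x ≈ y → ∣ x ∣ ≈ ∣ y ∣
  ∣∣-cong {x} {y} x≈y = ≤-antisym (∣∣-mono x≈y) (∣∣-mono (sym x≈y))
    where
    ∣∣-mono : ∀ {x y} → x ≈ y → ∣ x ∣ ≤ ∣ y ∣
    ∣∣-mono {x} {y} x≈y = proj₂ (proj₂ (supremum x (- x))) ∣ y ∣
      (≤-trans (≤-reflexive x≈y) (proj₁ (supremum y (- y))))
      (≤-trans (≤-reflexive (-‿cong x≈y)) (proj₁ (proj₂ (supremum y (- y)))))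

  ½+½≈1 : ½ + ½ ≈ 1#
  ½+½≈1 = trans (sym (trans (distribˡ ½ 1# 1#) (+-cong (*-identityʳ ½) (*-identityʳ ½))))
    -- Apartness makes the difference `1# + 1# - 0#` invertible, so `½` is the inverse of that
    -- difference and the zero has to be removed.
    (trans (*-congˡ (sym (x-0≈x (1# + 1#)))) (proj₁ (proj₂ (#⇒invertible 2#0))))

  ½x+½x≈x : ∀ x → ½ * x + ½ * x ≈ x
  ½x+½x≈x x = trans (sym (distribʳ x ½ ½)) (trans (*-congʳ ½+½≈1) (*-identityˡ x))

  -- Either `½` is positive outright or `½ < 1#`, and then `½ ≈ 1# - ½` is positive.
  0<½ : 0# < ½
  0<½ with <-cotrans 0<1 ½
  ... | inj₁ 0<½ = 0<½
  ... | inj₂ ½<1 = <-respʳ-≈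
    (trans (+-congʳ (sym ½+½≈1)) (//-rightDividesʳ ½ ½)) (x<y⇒0<y-x ½<1)

  0<½x : ∀ {x} → 0# < x → 0# < ½ * x
  0<½x = *-pos 0<½

  ½x<x : ∀ {x} → 0# < x → ½ * x < x
  ½x<x {x} 0<x = <-respˡ-≈ (+-identityˡ _)
    (<-respʳ-≈ (½x+½x≈x x) (+-monoˡ-< (½ * x) (0<½x 0<x)))

  x≤ε⇒x≤0 : ∀ {x} → (∀ ε → 0# < ε → x ≤ ε) → x ≤ 0#
  x≤ε⇒x≤0 {x} x≤ε 0<x = x≤ε (½ * x) (0<½x 0<x) (½x<x 0<x)

  -- Evaluating the difference quotient at both t and - t eliminates the
  -- second-order term q.
  slope≤ε : ∀ {t ε} x q → 0# < t → ∣ t * x + q ∣ ≤ ε * t → ∣ t * - x + q ∣ ≤ ε * t → x ≤ ε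
  slope≤ε {t} {ε} x q 0<t A B = *-cancelˡ-≤ 0<t+t
    (≤-resp-≈ lhs (solve 2 (λ ε t → ε :* t :+ ε :* t := (t :+ t) :* ε) refl ε t)
      (+-mono-≤ (∣x∣≤y⇒x≤y A) (∣x∣≤y⇒-x≤y B)))
    where
    0<t+t : 0# < t + t
    0<t+t = <-trans 0<t (<-respˡ-≈ (+-identityˡ t) (+-monoˡ-< t 0<t))
    -B : - (t * - x + q) ≈ t * x - q
    -B = trans (sym (-‿+-comm (t * - x) q))
      (+-congʳ (trans (-‿distribʳ-* t (- x)) (*-congˡ (-‿involutive x))))
    lhs : t * x + q + - (t * - x + q) ≈ (t + t) * x
    lhs = trans (+-congˡ -B) (trans
      (solve 4 (λ t x q -q → t :* x :+ q :+ (t :* x :+ -q) := (t :+ t) :* x :+ (q :+ -q))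
        refl t x q (- q))
      (trans (+-congˡ (-‿inverseʳ q)) (+-identityʳ _)))

-- Finite sums, inner products and matrix-vector products.

module LinearAlgebraProperties {c ℓ₁ ℓ₂ ℓ₃} (ℝ : Reals c ℓ₁ ℓ₂ ℓ₃) where
  open Reals ℝ hiding (zero)
  open LinearAlgebra ℝ
  open RealsProperties ℝ
  open CommutativeRing commutativeRing using (ring; semiring; commutativeSemiring)
  open IsStrictPartialOrder isStrictPartialOrder
    using (<-respˡ-≈) renaming (irrefl to <-irrefl; asym to <-asym)
  open RingProperties ring
  open SemiringSum semiring
    using (sum-cong-≋; sum-replicate-zero; ∑-distrib-+; ∑-comm; *-distribˡ-sum; *-distribʳ-sum)
  open SemiringSolver commutativeSemiring
    using (solve; _:+_; _:*_; _:=_)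

  infix  8 _∙_
  infixr 7 _*ⱽ_
  infixl 6 _+ⱽ_

  _∙_ : ∀ {n} → ℝ^ n → ℝ^ n → Carrier
  u ∙ v = sum λ i → u i * v i

  _+ⱽ_ : ∀ {n} → ℝ^ n → ℝ^ n → ℝ^ n
  (u +ⱽ v) i = u i + v i

  _*ⱽ_ : ∀ {k l} → Matrix k l → ℝ^ l → ℝ^ k
  (A *ⱽ v) a = A a ∙ v

  sum-≈0 : ∀ {n} {f : ℝ^ n} → (∀ i → f i ≈ 0#) → sum f ≈ 0#
  sum-≈0 {n} f≈0 = trans (sum-cong-≋ f≈0) (sum-replicate-zero n)

  sum-single : ∀ {n} {f : ℝ^ n} i → (∀ j → i ≢ j → f j ≈ 0#) → sum f ≈ f i
  sum-single zero    f≈0 =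
    trans (+-congˡ (sum-≈0 λ j → f≈0 (suc j) λ ())) (+-identityʳ _)
  sum-single (suc i) f≈0 = trans
    (+-cong (f≈0 zero λ ()) (sum-single i λ j i≢j → f≈0 (suc j) λ { ≡.refl → i≢j ≡.refl }))
    (+-identityˡ _)

  sum-splitAt : ∀ m {n} (f : ℝ^ (m +ℕ n)) →
                sum f ≈ sum (λ i → f (i ↑ˡ n)) + sum (λ j → f (m ↑ʳ j))
  sum-splitAt ℕ.zero    f = sym (+-identityˡ _)
  sum-splitAt (ℕ.suc m) f =
    trans (+-congˡ (sum-splitAt m (λ i → f (suc i)))) (sym (+-assoc _ _ _))

  sum-combine : ∀ N {p} (f : ℝ^ (N *ℕ p)) → sum f ≈ sum λ i → sum λ a → f (combine {N} i a)
  sum-combine ℕ.zero        f = refl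
  sum-combine (ℕ.suc N) {p} f =
    trans (sum-splitAt p f) (+-congˡ (sum-combine N (λ r → f (p ↑ʳ r))))

  sum-nonneg : ∀ {n} {f : ℝ^ n} → (∀ i → 0# ≤ f i) → 0# ≤ sum f
  sum-nonneg {ℕ.zero}  0≤f = ≤-reflexive refl
  sum-nonneg {ℕ.suc n} 0≤f = +-nonneg (0≤f zero) (sum-nonneg λ i → 0≤f (suc i))

  sum-+ : ∀ {n} {f g h : ℝ^ n} → (∀ i → f i ≈ g i + h i) → sum f ≈ sum g + sum h
  sum-+ {g = g} {h} f≈g+h = trans (sum-cong-≋ f≈g+h) (∑-distrib-+ g h)

  sum-*ˡ : ∀ {n} t {f g : ℝ^ n} → (∀ i → f i ≈ t * g i) → sum f ≈ t * sum g
  sum-*ˡ t {g = g} f≈tg = trans (sum-cong-≋ f≈tg) (sym (*-distribˡ-sum t g))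

  ∙-cong : ∀ {n} {u u′ v v′ : ℝ^ n} →
           (∀ i → u i ≈ u′ i) → (∀ i → v i ≈ v′ i) → u ∙ v ≈ u′ ∙ v′
  ∙-cong u≈u′ v≈v′ = sum-cong-≋ λ i → *-cong (u≈u′ i) (v≈v′ i)

  ∙-congˡ : ∀ {n} (u : ℝ^ n) {v v′ : ℝ^ n} → (∀ i → v i ≈ v′ i) → u ∙ v ≈ u ∙ v′
  ∙-congˡ u = ∙-cong λ _ → refl

  ∙-congʳ : ∀ {n} {u u′ : ℝ^ n} (v : ℝ^ n) → (∀ i → u i ≈ u′ i) → u ∙ v ≈ u′ ∙ v
  ∙-congʳ v u≈u′ = ∙-cong u≈u′ λ _ → refl

  ∙-comm : ∀ {n} (u v : ℝ^ n) → u ∙ v ≈ v ∙ u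
  ∙-comm u v = sum-cong-≋ λ i → *-comm (u i) (v i)

  ∙-distribˡ-+ : ∀ {n} (u v w : ℝ^ n) → u ∙ (v +ⱽ w) ≈ u ∙ v + u ∙ w
  ∙-distribˡ-+ u v w = sum-+ λ i → distribˡ (u i) (v i) (w i)

  ∙-distribʳ-+ : ∀ {n} (w u v : ℝ^ n) → (u +ⱽ v) ∙ w ≈ u ∙ w + v ∙ w
  ∙-distribʳ-+ w u v = sum-+ λ i → distribʳ (w i) (u i) (v i)

  ∙-*ˡ : ∀ {n} t (u v : ℝ^ n) → (λ i → t * u i) ∙ v ≈ t * (u ∙ v)
  ∙-*ˡ t u v = sum-*ˡ t λ i → *-assoc t (u i) (v i)

  ∙-adjoint : ∀ {k l} (A : Matrix k l) u v → u ∙ (A *ⱽ v) ≈ (A ᵀ *ⱽ u) ∙ v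
  ∙-adjoint A u v = trans
    (sum-cong-≋ λ a → sym (sum-*ˡ (u a) λ b →
      solve 3 (λ u A v → A :* u :* v := u :* (A :* v)) refl (u a) (A a b) (v b)))
    (trans (∑-comm λ a b → A a b * u a * v b) (sum-cong-≋ λ b →
      sym (*-distribʳ-sum (v b) λ a → A a b * u a)))

  -- Row `a` of the product is `B ᵀ` applied to row `a` of `A`, so this is an instance of
  -- adjointness.
  *ᴹ-*ⱽ-assoc : ∀ {k l q} (A : Matrix k l) (B : Matrix l q) v a →
                ((A *ᴹ B) *ⱽ v) a ≈ (A *ⱽ B *ⱽ v) a
  *ᴹ-*ⱽ-assoc A B v a =
    trans (∙-congʳ v λ b → ∙-comm (A a) (λ e → B e b)) (sym (∙-adjoint B (A a) v))

  diag-diagonal : ∀ {k} (d : ℝ^ k) a → diag d a a ≡ d a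
  diag-diagonal d a with a ≟ a
  ... | yes _   = ≡.refl
  ... | no  a≢a = contradiction ≡.refl a≢a

  diag-off-diagonal : ∀ {k} (d : ℝ^ k) {a b} → a ≢ b → diag d a b ≡ 0#
  diag-off-diagonal d {a} {b} a≢b with a ≟ b
  ... | yes a≡b = contradiction a≡b a≢b
  ... | no  _   = ≡.refl

  diag-*ⱽ : ∀ {k} (d v : ℝ^ k) a → (diag d *ⱽ v) a ≈ d a * v a
  diag-*ⱽ d v a = trans
    (sum-single a λ b a≢b → trans (*-congʳ (reflexive (diag-off-diagonal d a≢b))) (zeroˡ _))
    (*-congʳ (reflexive (diag-diagonal d a)))

  Iₘ-*ⱽ : ∀ {k} (v : ℝ^ k) a → (Iₘ *ⱽ v) a ≈ v a
  Iₘ-*ⱽ v a = trans (diag-*ⱽ _ v a) (*-identityˡ (v a))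

  -- Quadratic forms, congruence and semidefiniteness.

  quadraticForm-∙ : ∀ {k} (A : Matrix k k) v → quadraticForm A v ≈ v ∙ (A *ⱽ v)
  quadraticForm-∙ A v = sum-cong-≋ λ a → sum-*ˡ (v a) λ b → *-assoc (v a) (A a b) (v b)

  quadraticForm-congᴹ : ∀ {k} {A B : Matrix k k} → A ≈ᴹ B → ∀ v →
                        quadraticForm A v ≈ quadraticForm B v
  quadraticForm-congᴹ A≈B v =
    sum-cong-≋ λ a → sum-cong-≋ λ b → *-congʳ (*-congˡ (A≈B a b))

  quadraticForm-cong : ∀ {k} (A : Matrix k k) {v w} → (∀ a → v a ≈ w a) →
                       quadraticForm A v ≈ quadraticForm A w
  quadraticForm-cong A v≈w =
    sum-cong-≋ λ a → sum-cong-≋ λ b → *-cong (*-congʳ (v≈w a)) (v≈w b)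

  quadraticForm-+ᴹ : ∀ {k} (A B : Matrix k k) v →
                     quadraticForm (A +ᴹ B) v ≈ quadraticForm A v + quadraticForm B v
  quadraticForm-+ᴹ A B v = sum-+ λ a → sum-+ λ b →
    solve 4 (λ u A B v → u :* (A :+ B) :* v := u :* A :* v :+ u :* B :* v)
      refl (v a) (A a b) (B a b) (v b)

  *ᴹ-entry : ∀ {k q} (A : Matrix k k) (X : Matrix k q) a b →
             (X ᵀ *ᴹ A *ᴹ X) a b ≈ (X ᵀ) a ∙ (A *ⱽ (X ᵀ) b)
  *ᴹ-entry A X a b = *ᴹ-*ⱽ-assoc (X ᵀ) A ((X ᵀ) b) a

  -- Serves twice: with `X = V` to turn a splitting of eigenvalues into `M₁ = M₂ + M`, and with
  -- `X = z ⊗I` to carry that splitting over to `𝓑⁺`.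
  congruence-+ᴹ : ∀ {k q} {A B C : Matrix k k} → A ≈ᴹ B +ᴹ C → (X : Matrix k q) →
                  X ᵀ *ᴹ A *ᴹ X ≈ᴹ X ᵀ *ᴹ B *ᴹ X +ᴹ X ᵀ *ᴹ C *ᴹ X
  congruence-+ᴹ {A = A} {B} {C} A≈B+C X a b = trans (*ᴹ-entry A X a b) (trans
    (trans
      (∙-congˡ Xa λ r → trans (∙-congʳ Xb (A≈B+C r)) (∙-distribʳ-+ Xb (B r) (C r)))
      (∙-distribˡ-+ Xa (B *ⱽ Xb) (C *ⱽ Xb)))
    (sym (+-cong (*ᴹ-entry B X a b) (*ᴹ-entry C X a b))))
    where
    Xa = (X ᵀ) a
    Xb = (X ᵀ) b

  quadraticForm-congruence : ∀ {k q} (A : Matrix k k) (X : Matrix k q) v →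
    quadraticForm (X ᵀ *ᴹ A *ᴹ X) v ≈ quadraticForm A (X *ⱽ v)
  quadraticForm-congruence A X v = trans (quadraticForm-∙ (X ᵀ *ᴹ A *ᴹ X) v) (trans
    (∙-congˡ v λ a → trans (*ᴹ-*ⱽ-assoc (X ᵀ *ᴹ A) X v a) (*ᴹ-*ⱽ-assoc (X ᵀ) A (X *ⱽ v) a))
    (trans (∙-adjoint (X ᵀ) v (A *ⱽ X *ⱽ v)) (sym (quadraticForm-∙ A (X *ⱽ v)))))

  quadraticForm-diag-nonneg : ∀ {k} (d : ℝ^ k) → (∀ a → 0# ≤ d a) → ∀ v →
                              0# ≤ quadraticForm (diag d) v
  quadraticForm-diag-nonneg d 0≤d v = ≤-resp-≈ refl (sym eq)
      (sum-nonneg λ a → *-nonneg (0≤d a) (square-nonneg (v a)))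
    where
    eq : quadraticForm (diag d) v ≈ sum λ a → d a * (v a * v a)
    eq = trans (quadraticForm-∙ (diag d) v) (sum-cong-≋ λ a → trans (*-congˡ (diag-*ⱽ d v a))
      (solve 2 (λ v d → v :* (d :* v) := d :* (v :* v)) refl (v a) (d a)))

  -- Whether `v` is zero need not be decidable. If the form were negative at `v`, no entry of `v`
  -- could be apart from zero, so by tightness `v` would vanish and the form with it.
  PositiveDefinite⇒PositiveSemidefinite : ∀ {k} {A : Matrix k k} →
                                          PositiveDefinite A → PositiveSemidefinite A
  PositiveDefinite⇒PositiveSemidefinite {A = A} (symmetric , positive) = symmetric , λ v Av<0 →
    let v≈0 : ∀ a → v a ≈ 0#
        v≈0 a = proj₁ (tight (v a) 0#) λ va#0 → <-asym Av<0 (positive v (a , va#0))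
    in <-irrefl
         (sum-≈0 λ a → sum-≈0 λ b → trans (*-congˡ (v≈0 b)) (zeroʳ (v a * A a b)))
         Av<0

  -- Exact Taylor expansion and partial derivatives of quadratic forms.

  -- The gradient `(C + Cᵀ) z` of the form of `C`. It does not reduce to `2 C z`, since `C` is not
  -- assumed symmetric; the matrices `block M₂ a b` need not be when `a` and `b` differ.
  gradient : ∀ {N} → Matrix N N → ℝ^ N → ℝ^ N
  gradient C z = (C *ⱽ z) +ⱽ (C ᵀ *ⱽ z)

  *ⱽ-distribˡ-+ : ∀ {k l} (C : Matrix k l) u v a → (C *ⱽ (u +ⱽ v)) a ≈ (C *ⱽ u) a + (C *ⱽ v) a
  *ⱽ-distribˡ-+ C u v a = ∙-distribˡ-+ (C a) u v

  -- Bilinearity gives four terms; adjointness moves the cross term `z ∙ (C *ⱽ u)` onto `u`, where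
  -- it supplies the `C ᵀ` half of the gradient.
  quadraticForm-taylor : ∀ {N} (C : Matrix N N) z u →
    quadraticForm C (z +ⱽ u) ≈ quadraticForm C z + u ∙ gradient C z + quadraticForm C u
  quadraticForm-taylor C z u = begin
    quadraticForm C (z +ⱽ u)
      ≈⟨ quadraticForm-∙ C (z +ⱽ u) ⟩
    (z +ⱽ u) ∙ (C *ⱽ (z +ⱽ u))
      ≈⟨ ∙-distribʳ-+ (C *ⱽ (z +ⱽ u)) z u ⟩
    z ∙ (C *ⱽ (z +ⱽ u)) + u ∙ (C *ⱽ (z +ⱽ u))
      ≈⟨ +-cong (expand z) (expand u) ⟩
    (z ∙ (C *ⱽ z) + z ∙ (C *ⱽ u)) + (u ∙ (C *ⱽ z) + u ∙ (C *ⱽ u))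
      ≈⟨ +-congʳ (+-congˡ (trans (∙-adjoint C z u) (∙-comm (C ᵀ *ⱽ z) u))) ⟩
    (z ∙ (C *ⱽ z) + u ∙ (C ᵀ *ⱽ z)) + (u ∙ (C *ⱽ z) + u ∙ (C *ⱽ u))
      ≈⟨ solve 4 (λ a b c d → (a :+ b) :+ (c :+ d) := a :+ (c :+ b) :+ d) refl _ _ _ _ ⟩
    z ∙ (C *ⱽ z) + (u ∙ (C *ⱽ z) + u ∙ (C ᵀ *ⱽ z)) + u ∙ (C *ⱽ u)
      ≈⟨ +-cong (+-cong (sym (quadraticForm-∙ C z)) (sym (∙-distribˡ-+ u (C *ⱽ z) (C ᵀ *ⱽ z))))
                (sym (quadraticForm-∙ C u)) ⟩
    quadraticForm C z + u ∙ gradient C z + quadraticForm C u ∎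
    where
    open SetoidReasoning setoid
    expand : ∀ w → w ∙ (C *ⱽ (z +ⱽ u)) ≈ w ∙ (C *ⱽ z) + w ∙ (C *ⱽ u)
    expand w = trans (∙-congˡ w (*ⱽ-distribˡ-+ C z u)) (∙-distribˡ-+ w (C *ⱽ z) (C *ⱽ u))

  quadraticForm-* : ∀ {N} (C : Matrix N N) t u →
    quadraticForm C (λ i → t * u i) ≈ t * t * quadraticForm C u
  quadraticForm-* C t u = sum-*ˡ (t * t) λ i → sum-*ˡ (t * t) λ j →
    solve 4 (λ t u C v → t :* u :* C :* (t :* v) := t :* t :* (u :* C :* v))
      refl t (u i) (C i j) (u j)

  -- Row `Iₘ i` is the basis vector along coordinate `i`, so a coordinate update becomes a
  -- translation to which the Taylor expansion applies.
  updateAt-+ : ∀ {N} (z : ℝ^ N) i t j → updateAt z i (_+ t) j ≈ z j + t * Iₘ i j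
  updateAt-+ z i t j with i ≟ j
  ... | yes ≡.refl = trans (reflexive (updateAt-updates i z)) (+-congˡ (sym (*-identityʳ t)))
  ... | no  i≢j    = trans
    (reflexive (updateAt-minimal j i z λ j≡i → i≢j (≡.sym j≡i)))
    (sym (trans (+-congˡ (zeroʳ t)) (+-identityʳ (z j))))

  quadraticForm-updateAt : ∀ {N} (C : Matrix N N) z i t →
    quadraticForm C (updateAt z i (_+ t)) ≈
    quadraticForm C z + (t * gradient C z i + t * t * quadraticForm C (Iₘ i))
  quadraticForm-updateAt C z i t = trans
    (trans (quadraticForm-cong C (updateAt-+ z i t)) (quadraticForm-taylor C z _))
    (trans
      (+-cong
        (+-congˡ (trans (∙-*ˡ t (Iₘ i) (gradient C z)) (*-congˡ (Iₘ-*ⱽ (gradient C z) i))))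
        (quadraticForm-* C t (Iₘ i)))
      (+-assoc _ _ _))

  -- With `x = e - d`, the error of the slope `d` at step `s` is exactly `s * x + s * s * q`.
  -- Bounding it at two opposite steps shows that `x` and `- x` lie below every positive `ε`.
  HasPartialDerivative-unique : ∀ {N} (f : ℝ^ N → Carrier) i z {d e q} →
    (∀ t → f (updateAt z i (_+ t)) ≈ f z + (t * e + t * t * q)) →
    HasPartialDerivative f i z d → d ≈ e
  HasPartialDerivative-unique f i z {d} {e} {q} f-expansion ∂f =
    sym (x∙y⁻¹≈ε⇒x≈y e d (≤-antisym x≤0 (λ x<0 → -x≤0 (x<0⇒0<-x x<0))))
    where
    x : Carrier
    x = e - d

    quotient : ∀ s → f (updateAt z i (_+ s)) - f z - s * d ≈ s * x + s * s * q
    quotient s = trans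
      (+-congʳ (trans (+-congʳ (f-expansion s)) (xyx⁻¹≈y (f z) _)))
      (trans (+-congˡ (-‿distribʳ-* s d))
        (solve 4 (λ s e q -d → s :* e :+ s :* s :* q :+ s :* -d := s :* (e :+ -d) :+ s :* s :* q)
          refl s e q (- d)))

    ±x≤ε : ∀ ε → 0# < ε → x ≤ ε × - x ≤ ε
    ±x≤ε ε 0<ε with ∂f ε 0<ε
    -- Replacing `x` by `- x` exchanges the roles of the steps `t` and `- t`, so the same two bounds
    -- serve both signs.
    ... | η , 0<η , bound = slope≤ε x tt 0<t A B , slope≤ε (- x) tt 0<t B A′
      where
      t tt : Carrier
      -- Any positive step strictly below the radius `η` would do.
      t = ½ * η
      tt = t * t * q
      0<t : 0# < t
      0<t = 0<½x 0<η
      bound′ : ∀ s {y} → ∣ s ∣ ≈ t → s * x + s * s * q ≈ y → ∣ y ∣ ≤ ε * t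
      bound′ s ∣s∣≈t eq = ≤-resp-≈ (∣∣-cong (trans (quotient s) eq)) (*-congˡ ∣s∣≈t)
        (bound s (<-respˡ-≈ (sym ∣s∣≈t) (½x<x 0<η)))
      A : ∣ t * x + tt ∣ ≤ ε * t
      A = bound′ t (0<x⇒∣x∣≈x 0<t) refl
      A′ : ∣ t * - - x + tt ∣ ≤ ε * t
      A′ = bound′ t (0<x⇒∣x∣≈x 0<t) (+-congʳ (*-congˡ (sym (-‿involutive x))))
      B : ∣ t * - x + tt ∣ ≤ ε * t
      B = bound′ (- t) (0<x⇒∣-x∣≈x 0<t)
        (+-cong (trans (sym (-‿distribˡ-* t x)) (-‿distribʳ-* t x)) (*-congʳ (-x*-x≈x*x t)))

    x≤0 : x ≤ 0#
    x≤0 = x≤ε⇒x≤0 λ ε 0<ε → proj₁ (±x≤ε ε 0<ε)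
    -x≤0 : - x ≤ 0#
    -x≤0 = x≤ε⇒x≤0 λ ε 0<ε → proj₂ (±x≤ε ε 0<ε)

-- Products with `z ⊗I`, entry by entry.

module KroneckerProperties {c ℓ₁ ℓ₂ ℓ₃} (ℝ : Reals c ℓ₁ ℓ₂ ℓ₃) (N p : ℕ) where
  open Reals ℝ hiding (zero)
  open LinearAlgebra ℝ
  open LinearAlgebraProperties ℝ
  open CommutativeRing commutativeRing using (semiring)
  open SemiringSum semiring using (sum-cong-≋)

  -- Fixes the offsets and lets the block indices vary, so that a matrix-valued quadratic in `z`
  -- becomes one scalar quadratic form per entry.
  block : Matrix (N *ℕ p) (N *ℕ p) → Fin p → Fin p → Matrix N N
  block A a b i j = A (combine i a) (combine j b)

  -- Column `b` of `z ⊗I` vanishes except at offset `b` of each block, where it equals `z i`; only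
  -- those terms of the sum survive.
  ∙-⊗I : ∀ (f : ℝ^ (N *ℕ p)) (z : ℝ^ N) (b : Fin p) →
         f ∙ ((z ⊗I) ᵀ) b ≈ (λ i → f (combine i b)) ∙ z
  ∙-⊗I f z b = trans (sum-combine N λ r → f r * (z ⊗I) r b) (sum-cong-≋ λ i → trans
    (sum-single b λ a b≢a → trans
      (*-congˡ (trans (⊗I-combine i a)
        (trans (*-congˡ (reflexive (diag-off-diagonal _ λ a≡b → b≢a (≡.sym a≡b)))) (zeroʳ (z i)))))
      (zeroʳ (f (combine i a))))
    (*-congˡ (trans (⊗I-combine i b)
      (trans (*-congˡ (reflexive (diag-diagonal _ b))) (*-identityʳ (z i))))))
    where
    ⊗I-combine : ∀ i a → (z ⊗I) (combine i a) b ≈ z i * Iₘ a b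
    ⊗I-combine i a = reflexive (≡.cong (λ (j , e) → z j * Iₘ e b) (remQuot-combine i a))

  congruence-⊗I : ∀ (A : Matrix (N *ℕ p) (N *ℕ p)) (z : ℝ^ N) (a b : Fin p) →
    ((z ⊗I) ᵀ *ᴹ A *ᴹ (z ⊗I)) a b ≈ quadraticForm (block A a b) z
  congruence-⊗I A z a b = trans (*ᴹ-entry A (z ⊗I) a b) (trans
    (∙-comm (((z ⊗I) ᵀ) a) _) (trans
    (∙-⊗I (A *ⱽ ((z ⊗I) ᵀ) b) z a) (trans
    (∙-congʳ z λ i → ∙-⊗I (A (combine i a)) z b) (trans
    (∙-comm _ z)
    (sym (quadraticForm-∙ (block A a b) z))))))

-- The identity `𝓑⁺ = 𝓑 + 𝓑⁻` and positivity of `𝓑⁻`.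

module DecompositionProperties {c ℓ₁ ℓ₂ ℓ₃} (ℝ : Reals c ℓ₁ ℓ₂ ℓ₃)
    {m n p : ℕ} (P : BMI.Problem ℝ m n p)
    (E : LinearAlgebra.Eigendecomposition ℝ (BMI.Problem.M P)) where
  open Reals ℝ hiding (zero)
  open LinearAlgebra ℝ
  open BMI ℝ
  open Problem P
  open Eigendecomposition E
  open Decomposition P E
  open RealsProperties ℝ
  open LinearAlgebraProperties ℝ
  open KroneckerProperties ℝ (m +ℕ n) p
  open CommutativeRing commutativeRing using (ring; semiring; commutativeSemiring)
  open RingProperties ring
  open SemiringSum semiring using (sum-cong-≋; ∑-comm)
  open SemiringSolver commutativeSemiring using (solve; _:+_; _:*_; _:=_)
  open SetoidReasoning setoid

  D⁻-nonneg : ∀ v → 0# ≤ quadraticForm D⁻ v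
  D⁻-nonneg v = ≤-resp-≈ refl (sym (quadraticForm-congᴹ D⁻≈diag v))
      (quadraticForm-diag-nonneg _ (λ r → x≤y⇒0≤y-x (proj₁ (supremum (eigenvalues r) 0#))) v)
    where
    D⁻≈diag : D⁻ ≈ᴹ diag (λ r → (eigenvalues r ⊔ 0#) - eigenvalues r)
    -- `D⁻` is a difference of two diagonal matrices, so off the diagonal its entries are `0# - 0#`.
    D⁻≈diag r s with r ≟ s
    ... | yes _ = refl
    ... | no  _ = -‿inverseʳ 0#

  -- Two congruences, by `u ⊗I` and by `V`, reduce the form to that of `D⁻`.
  𝓑⁻-nonneg : ∀ u v → 0# ≤ quadraticForm (𝓑⁻ u) v
  𝓑⁻-nonneg u v = ≤-resp-≈ refl
    (sym (trans (quadraticForm-congruence M₂ (u ⊗I) v)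
      (quadraticForm-congruence D⁻ V ((u ⊗I) *ⱽ v))))
    (D⁻-nonneg (V *ⱽ (u ⊗I) *ⱽ v))

  M₁≈M₂+M : M₁ ≈ᴹ M₂ +ᴹ M
  M₁≈M₂+M r s = trans
    (congruence-+ᴹ {A = D⁺} {D⁻} {D} (λ e f → sym (//-rightDividesˡ (D e f) (D⁺ e f))) V r s)
    (+-congˡ (sym (A≈VᵀDV r s)))

  split-combine : ∀ k a → split (combine k a) ≡
    Sum.map (λ i → combine i a) (λ j → combine j a) (splitAt m k)
  split-combine k a = ≡.cong
    (λ (k , a) → Sum.map (λ i → combine i a) (λ j → combine j a) (splitAt m k))
    (remQuot-combine k a)

  split-combineˡ : ∀ i a → split (combine (i ↑ˡ n) a) ≡ inj₁ (combine i a)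
  split-combineˡ i a = ≡.trans (split-combine (i ↑ˡ n) a) (≡.cong (Sum.map _ _) (splitAt-↑ˡ m i n))

  split-combineʳ : ∀ j a → split (combine (m ↑ʳ j) a) ≡ inj₂ (combine j a)
  split-combineʳ j a = ≡.trans (split-combine (m ↑ʳ j) a) (≡.cong (Sum.map _ _) (splitAt-↑ʳ m n j))

  Γ-combine : ∀ i a j b → Γ (combine i a) (combine j b) ≡ ½ * Fᵢⱼ i j a b
  Γ-combine i a j b = ≡.cong₂ (λ (i , a) (j , b) → ½ * Fᵢⱼ i j a b)
    (remQuot-combine i a) (remQuot-combine j b)

  Ω-combine : ∀ k a b → Ω a (combine k b) ≡ (H ++ G) k a b
  Ω-combine k a b = ≡.cong (λ (k , b) → (H ++ G) k a b) (remQuot-combine k b)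

  -- `M r s` unfolds to `fromSplit (split r) (split s)`, so evaluating the two `split`s evaluates
  -- the entry.
  fromSplit : Fin (m *ℕ p) ⊎ Fin (n *ℕ p) → Fin (m *ℕ p) ⊎ Fin (n *ℕ p) → Carrier
  fromSplit = fromBlocks 0ᴹ Γ (Γ ᵀ) 0ᴹ

  module _ (z : ℝ^ (m +ℕ n)) (a b : Fin p) where
    private
      x = take m z
      y = drop m z
      N = block M a b

    M-diagonalˡ : ∀ i i′ → N (i ↑ˡ n) (i′ ↑ˡ n) ≡ 0#
    M-diagonalˡ i i′ = ≡.cong₂ fromSplit (split-combineˡ i a) (split-combineˡ i′ b)

    M-diagonalʳ : ∀ j j′ → N (m ↑ʳ j) (m ↑ʳ j′) ≡ 0#
    M-diagonalʳ j j′ = ≡.cong₂ fromSplit (split-combineʳ j a) (split-combineʳ j′ b)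

    M-upper : ∀ i j → N (i ↑ˡ n) (m ↑ʳ j) ≡ ½ * Fᵢⱼ i j a b
    M-upper i j = ≡.trans
      (≡.cong₂ fromSplit (split-combineˡ i a) (split-combineʳ j b)) (Γ-combine i a j b)

    M-lower : ∀ i j → N (m ↑ʳ j) (i ↑ˡ n) ≡ ½ * Fᵢⱼ i j b a
    M-lower i j = ≡.trans
      (≡.cong₂ fromSplit (split-combineʳ j a) (split-combineˡ i b)) (Γ-combine i b j a)

    -- The diagonal blocks of `M` vanish and each off-diagonal block contributes half of the
    -- bilinear sum.
    bilinearTerm : ((z ⊗I) ᵀ *ᴹ M *ᴹ (z ⊗I)) a b ≈
                   ∑ᴹ (λ i → ∑ᴹ λ j → (x i * y j) ·ᴹ Fᵢⱼ i j) a b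
    bilinearTerm = begin
      ((z ⊗I) ᵀ *ᴹ M *ᴹ (z ⊗I)) a b
        ≈⟨ congruence-⊗I M z a b ⟩
      quadraticForm N z
        ≈⟨ sum-splitAt m (λ i → sum (T i)) ⟩
      (sum λ i → sum (T (i ↑ˡ n))) + (sum λ j → sum (T (m ↑ʳ j)))
        ≈⟨ +-cong (sum-cong-≋ rowˡ) (sum-cong-≋ rowʳ) ⟩
      (sum λ i → sum (U i)) + (sum λ j → sum λ i → U i j)
        ≈⟨ +-congˡ (sym (∑-comm U)) ⟩
      (sum λ i → sum (U i)) + (sum λ i → sum (U i))
        ≈⟨ sym (sum-+ λ i → sum-+ λ j → sym (U+U i j)) ⟩
      (sum λ i → sum λ j → x i * y j * Fᵢⱼ i j a b) ∎
      where
      T : Fin (m +ℕ n) → ℝ^ (m +ℕ n)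
      T k l = z k * N k l * z l
      U : Fin m → Fin n → Carrier
      U i j = ½ * (x i * y j * Fᵢⱼ i j a b)
      U+U : ∀ i j → U i j + U i j ≈ x i * y j * Fᵢⱼ i j a b
      U+U i j = ½x+½x≈x _
      vanish : ∀ {s t e} → e ≡ 0# → s * e * t ≈ 0#
      vanish {t = t} ≡.refl = trans (*-congʳ (zeroʳ _)) (zeroˡ t)
      rowˡ : ∀ i → sum (T (i ↑ˡ n)) ≈ sum (U i)
      rowˡ i = trans (sum-splitAt m (T (i ↑ˡ n))) (trans
        (+-cong (sum-≈0 λ i′ → vanish (M-diagonalˡ i i′)) (sum-cong-≋ λ j →
          trans (*-congʳ (*-congˡ (reflexive (M-upper i j))))
            (solve 4 (λ x h F y → x :* (h :* F) :* y := h :* (x :* y :* F))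
              refl (x i) ½ (Fᵢⱼ i j a b) (y j))))
        (+-identityˡ _))
      rowʳ : ∀ j → sum (T (m ↑ʳ j)) ≈ sum λ i → U i j
      rowʳ j = trans (sum-splitAt m (T (m ↑ʳ j))) (trans
        (+-cong
          (sum-cong-≋ λ i →
            trans (*-congʳ (*-congˡ (trans (reflexive (M-lower i j))
                                           -- The lower block is the transpose of `Γ` and yields
                                           -- entry `b a`; symmetry of `Fᵢⱼ` matches it with the
                                           -- upper one.
                                           (*-congˡ (Fᵢⱼ-symmetric i j a b)))))
              (solve 4 (λ x h F y → y :* (h :* F) :* x := h :* (x :* y :* F))
                refl (x i) ½ (Fᵢⱼ i j a b) (y j)))
          (sum-≈0 λ j′ → vanish (M-diagonalʳ j j′)))
        (+-identityʳ _))

    linearTerm : (Ω *ᴹ (z ⊗I)) a b ≈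
                 ∑ᴹ (λ i → x i ·ᴹ H i) a b + ∑ᴹ (λ j → y j ·ᴹ G j) a b
    linearTerm = begin
      Ω a ∙ ((z ⊗I) ᵀ) b
        ≈⟨ ∙-⊗I (Ω a) z b ⟩
      (λ k → Ω a (combine k b)) ∙ z
        ≈⟨ sum-splitAt m (λ k → Ω a (combine k b) * z k) ⟩
      (sum λ i → Ω a (combine (i ↑ˡ n) b) * x i) + (sum λ j → Ω a (combine (m ↑ʳ j) b) * y j)
        ≈⟨ +-cong (sum-cong-≋ λ i → trans (*-congʳ (reflexive (Ω-H i))) (*-comm _ (x i)))
                  (sum-cong-≋ λ j → trans (*-congʳ (reflexive (Ω-G j))) (*-comm _ (y j))) ⟩
      (sum λ i → x i * H i a b) + (sum λ j → y j * G j a b) ∎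
      where
      Ω-H : ∀ i → Ω a (combine (i ↑ˡ n) b) ≡ H i a b
      Ω-H i = ≡.trans (Ω-combine (i ↑ˡ n) a b) (≡.cong (λ X → X a b) (lookup-++ˡ H G i))
      Ω-G : ∀ j → Ω a (combine (m ↑ʳ j) b) ≡ G j a b
      Ω-G j = ≡.trans (Ω-combine (m ↑ʳ j) a b) (≡.cong (λ X → X a b) (lookup-++ʳ H G j))

  -- The `M₂` part of `M₁` is `𝓑⁻`, its `M` part gives the bilinear terms, and `Ω` gives the linear
  -- ones.
  𝓑⁺≈𝓑+𝓑⁻ : ∀ z → 𝓑⁺ z ≈ᴹ 𝓑[ z ] +ᴹ 𝓑⁻ z
  𝓑⁺≈𝓑+𝓑⁻ z a b = trans
    (+-congʳ (+-cong
      (trans (congruence-+ᴹ M₁≈M₂+M (z ⊗I) a b) (+-congˡ (bilinearTerm z a b)))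
      (linearTerm z a b)))
    (solve 5 (λ q s h g f → q :+ s :+ (h :+ g) :+ f := f :+ h :+ g :+ s :+ q) refl _ _ _ _ _)

  0-𝓑-symmetric : ∀ z → Symmetric (0ᴹ -ᴹ 𝓑[ z ])
  0-𝓑-symmetric z a b = +-congˡ (-‿cong (+-cong (+-cong (+-cong
    (F-symmetric a b)
    (sum-cong-≋ λ i → *-congˡ (H-symmetric i a b)))
    (sum-cong-≋ λ j → *-congˡ (G-symmetric j a b)))
    (sum-cong-≋ λ i → sum-cong-≋ λ j → *-congˡ (Fᵢⱼ-symmetric i j a b))))

  -- Linearisation of `𝓑⁻` and the convex subproblem.

  module _ {∂𝓑⁻ : Fin (m +ℕ n) → ℝ^ (m +ℕ n) → Matrix p p}
           (partials : IsPartialsOf𝓑⁻ ∂𝓑⁻) (δ ε : Carrier) where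
    open Algorithm ∂𝓑⁻ δ ε

    -- `∂𝓑⁻` is given only through the limit definition. Each entry of `𝓑⁻` is exactly quadratic
    -- along a coordinate line, which determines the derivative.
    ∂𝓑⁻≈gradient : ∀ i z a b → ∂𝓑⁻ i z a b ≈ gradient (block M₂ a b) z i
    ∂𝓑⁻≈gradient i z a b = HasPartialDerivative-unique (λ w → 𝓑⁻ w a b) i z
      (λ t → trans (congruence-⊗I M₂ (updateAt z i (_+ t)) a b) (trans
        (quadraticForm-updateAt (block M₂ a b) z i t)
        (+-congʳ (sym (congruence-⊗I M₂ z a b)))))
      (partials i z a b)

    𝓑⁻-taylor : ∀ z w → 𝓑⁻ w ≈ᴹ 𝓑⁻ z +ᴹ 𝓓𝓑⁻ z (w -ⱽ z) +ᴹ 𝓑⁻ (w -ⱽ z)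
    𝓑⁻-taylor z w a b = begin
      𝓑⁻ w a b
        ≈⟨ congruence-⊗I M₂ w a b ⟩
      quadraticForm C w
        ≈⟨ quadraticForm-cong C (λ i → sym (trans (+-comm (z i) _) (//-rightDividesˡ (z i) (w i)))) ⟩
      quadraticForm C (z +ⱽ u)
        ≈⟨ quadraticForm-taylor C z u ⟩
      quadraticForm C z + u ∙ gradient C z + quadraticForm C u
        ≈⟨ sym (+-cong
             (+-cong (congruence-⊗I M₂ z a b) (∙-congˡ u λ i → ∂𝓑⁻≈gradient i z a b))
             (congruence-⊗I M₂ u a b)) ⟩
      𝓑⁻ z a b + 𝓓𝓑⁻ z u a b + 𝓑⁻ u a b ∎
      where
      u = w -ⱽ z
      C = block M₂ a b

    -- The negated `𝓑[ w ]` is the slack of the linearised constraint plus `𝓑⁻ (w -ⱽ z)`, and both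
    -- have nonnegative forms.
    SubproblemFeasible⇒Feasible : ∀ z w → SubproblemFeasible z w → Feasible w
    SubproblemFeasible⇒Feasible z w (_ , nonneg) =
      0-𝓑-symmetric w ,
      λ v → ≤-resp-≈ refl
        (sym (trans (quadraticForm-congᴹ decomposition v) (quadraticForm-+ᴹ _ _ v)))
        (+-nonneg (nonneg v) (𝓑⁻-nonneg (w -ⱽ z) v))
      where
      decomposition : 0ᴹ -ᴹ 𝓑[ w ] ≈ᴹ
        (0ᴹ -ᴹ (𝓑⁺ w -ᴹ 𝓑⁻ z -ᴹ 𝓓𝓑⁻ z (w -ⱽ z))) +ᴹ 𝓑⁻ (w -ⱽ z)
      decomposition a b = sym (begin
        0# - (𝓑⁺ w a b - r - d) + q
          ≈⟨ +-congʳ (+-congˡ (-‿cong linearised)) ⟩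
        0# - (e + q) + q
          ≈⟨ +-congʳ (+-congˡ (sym (-‿+-comm e q))) ⟩
        0# + (- e + - q) + q
          ≈⟨ +-congʳ (sym (+-assoc 0# (- e) (- q))) ⟩
        0# - e - q + q
          ≈⟨ //-rightDividesˡ q (0# - e) ⟩
        0# - e ∎)
        where
        e = 𝓑[ w ] a b
        r = 𝓑⁻ z a b
        d = 𝓓𝓑⁻ z (w -ⱽ z) a b
        q = 𝓑⁻ (w -ⱽ z) a b
        linearised : 𝓑⁺ w a b - r - d ≈ e + q
        linearised = begin
          𝓑⁺ w a b - r - d
            ≈⟨ +-congʳ (+-congʳ (trans (𝓑⁺≈𝓑+𝓑⁻ w a b) (+-congˡ (𝓑⁻-taylor z w a b)))) ⟩
          e + (r + d + q) - r - d
            ≈⟨ +-congʳ (+-congʳ (solve 4 (λ e r d q → e :+ (r :+ d :+ q) := e :+ q :+ d :+ r)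
                 refl e r d q)) ⟩
          e + q + d + r - r - d
            ≈⟨ +-congʳ (//-rightDividesʳ r (e + q + d)) ⟩
          e + q + d - d
            ≈⟨ //-rightDividesʳ d (e + q) ⟩
          e + q ∎

theorem9 : ∀ {c ℓ₁ ℓ₂ ℓ₃} (ℝ : Reals c ℓ₁ ℓ₂ ℓ₃) →
    let open Reals ℝ in
    let open LinearAlgebra ℝ in
    let open BMI ℝ in
    (m n p : ℕ) (P : Problem m n p) →
    let open Problem P in
    (E : Eigendecomposition M) →
    let open Decomposition P E in
    (∂𝓑⁻ : Fin (m +ℕ n) → ℝ^ (m +ℕ n) → Matrix p p) → IsPartialsOf𝓑⁻ ∂𝓑⁻ →
    (δ ε : Carrier) → δ < 0# → 0# ≤ ε →
    let open Algorithm ∂𝓑⁻ δ ε in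
    (z : ℕ → ℝ^ (m +ℕ n)) → StrictlyFeasible (z 0) →
    ∀ k → Produced z k → Feasible (z k)
theorem9 ℝ m n p P E ∂𝓑⁻ partials δ ε δ<0 0≤ε z strict _ BMI.Decomposition.Algorithm.start =
  LinearAlgebraProperties.PositiveDefinite⇒PositiveSemidefinite ℝ strict
-- Optimality of the new iterate includes its feasibility for the subproblem at `z k`.
theorem9 ℝ m n p P E ∂𝓑⁻ partials δ ε δ<0 0≤ε z strict (ℕ.suc k)
  (BMI.Decomposition.Algorithm.next _ _ (feasible , _)) =
  DecompositionProperties.SubproblemFeasible⇒Feasible ℝ P E partials δ ε (z k) (z (ℕ.suc k)) feasible
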